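{- Let $\mathbf{L}\in\mathbf{DQD}$ with $|L|>2$. Then the following are equivalent: (a) $\mathbf{L}$ is a subdirectly irreducible algebra in $\mathbf{JID_1}$; (b) $\mathbf{L}$ is a simple algebra in $\mathbf{JID_1}$; (c) $\mathbf{L}\in\mathbf{JID_1}$ and, for every $x\in L$, if $x\neq 1$ then $x\wedge (x')^*=0$; (d) either $\mathbf{L}$ is isomorphic to one of $\mathbf{D_1},\mathbf{D_2},\mathbf{D_3}$, or $\mathbf{L}\in\mathbf{DSt}$ and, for every $x\in L$, if $x\neq 1$ then $x\wedge (x')^*=0$.
   Context: A semi-Heyting algebra is an algebra $\langle L,\vee,\wedge,\to,0,1\rangle$ such that $\langle L,\vee,\wedge,0,1\rangle$ is a bounded lattice and the identities $x\wedge(x\to y)\approx x\wedge y$, $x\wedge(y\to z)\approx x\wedge[(x\wedge y)\to(x\wedge z)]$, $x\to x\approx 1$ hold; write $x^*:=x\to 0$. A $\mathbf{DQD}$-algebra (dually quasi-De Morgan semi-Heyting algebra) is an algebra $\langle L,\vee,\wedge,\to,{}',0,1\rangle$ whose reduct $\langle L,\vee,\wedge,\to,0,1\rangle$ is a semi-Heyting algebra and which satisfies: $0'\approx 1$ and $1'\approx 0$; $(x\wedge y)'\approx x'\vee y'$; $(x\vee y)''\approx x''\vee y''$; $x''\le x$. $\mathbf{DQD}$ denotes the variety of all $\mathbf{DQD}$-algebras. $\mathbf{DSt}$ is the subvariety of $\mathbf{DQD}$ defined by $x'\wedge x''\approx 0$. $\mathbf{JID}$ is the subvariety of $\mathbf{DQD}$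 defined by $x'\vee(y\to z)\approx(x'\vee y)\to(x'\vee z)$, and $\mathbf{JID_1}$ is the subvariety of $\mathbf{JID}$ defined by $x\wedge x'^{*}\approx (x\wedge x'^{*})'^{*}$ (where $z'^*$ means $(z')^*$); relative to $\mathbf{JID}$ this is equivalent to the level-1 identity $x\wedge x'^*\approx x\wedge x'^*\wedge x'^*{}'^*$. The algebras $\mathbf{D_1},\mathbf{D_2},\mathbf{D_3}$ all have universe $\{0,a,b,1\}$ with the four-element Boolean lattice order ($a,b$ complementary atoms), and $0'=1$, $1'=0$, $a'=a$, $b'=b$. The operation $\to$ is given by listing, for each $x$, the tuple $(x\to 0,\ x\to 1,\ x\to a,\ x\to b)$. In $\mathbf{D_1}$: $x=0$: $(1,0,b,a)$; $x=1$: $(0,1,a,b)$; $x=a$: $(b,a,1,0)$; $x=b$: $(a,b,0,1)$. In $\mathbf{D_2}$: $x=0$: $(1,1,1,1)$; $x=1$: $(0,1,a,b)$; $x=a$: $(b,1,1,b)$; $x=b$: $(a,1,a,1)$. In $\mathbf{D_3}$: $x=0$: $(1,a,1,a)$; $x=1$: $(0,1,a,b)$; $x=a$: $(b,a,1,0)$; $x=b$: $(a,1,a,1)$. -}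

module Defs where

open import Algebra.Core using (Op₁; Op₂)
open import Algebra.Definitions using (Congruent₁; Congruent₂; Zero)
open import Algebra.Lattice.Structures using (IsLattice)
open import Algebra.Morphism.Definitions using (Homomorphic₀; Homomorphic₁; Homomorphic₂)
open import Data.Product.Base using (_×_; ∃-syntax)
open import Data.Sum.Base using (_⊎_)
open import Function.Base using (_∘_)
open import Function.Definitions using (Congruent; Injective; Surjective; Bijective)
open import Level using (Level; _⊔_; suc; 0ℓ)
open import Relation.Binary.Core using (Rel)
open import Relation.Binary.Structures using (IsEquivalence)
open import Relation.Binary.PropositionalEquality as ≡ using (_≡_)
open import Relation.Nullary.Negation using (¬_)
open import Relation.Unary using (Pred; _∈_)

private
  variable
    c ℓ c₁ ℓ₁ c₂ ℓ₂ : Level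

-- Algebras of type ⟨∨, ∧, ⇒, ′, 0, 1⟩, with no identities imposed.
-- The equality of the carrier is a setoid equality.

record Algebra (c ℓ : Level) : Set (suc (c ⊔ ℓ)) where
  infix  4 _≈_ _≤_
  infixr 5 _⇒_
  infixr 6 _∨_
  infixr 7 _∧_
  infixl 9 _′ _*
  field
    Carrier       : Set c
    _≈_           : Rel Carrier ℓ
    _∨_           : Op₂ Carrier
    _∧_           : Op₂ Carrier
    _⇒_           : Op₂ Carrier
    _′            : Op₁ Carrier
    0#            : Carrier
    1#            : Carrier
    isEquivalence : IsEquivalence _≈_
    ∨-cong        : Congruent₂ _≈_ _∨_
    ∧-cong        : Congruent₂ _≈_ _∧_
    ⇒-cong        : Congruent₂ _≈_ _⇒_
    ′-cong        : Congruent₁ _≈_ _′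

  _* : Op₁ Carrier
  x * = x ⇒ 0#

  _≤_ : Rel Carrier ℓ
  x ≤ y = x ∧ y ≈ x

record IsSemiHeyting (L : Algebra c ℓ) : Set (c ⊔ ℓ) where
  open Algebra L
  field
    isLattice : IsLattice _≈_ _∨_ _∧_
    ∧-zero    : Zero _≈_ 0# _∧_
    ∨-zero    : Zero _≈_ 1# _∨_
    ∧-⇒       : ∀ x y → x ∧ (x ⇒ y) ≈ x ∧ y
    ∧-⇒-∧     : ∀ x y z → x ∧ (y ⇒ z) ≈ x ∧ ((x ∧ y) ⇒ (x ∧ z))
    ⇒-refl    : ∀ x → x ⇒ x ≈ 1#

record IsDQD (L : Algebra c ℓ) : Set (c ⊔ ℓ) where
  open Algebra L
  field
    isSemiHeyting : IsSemiHeyting L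
    0′≈1          : 0# ′ ≈ 1#
    1′≈0          : 1# ′ ≈ 0#
    ∧-′           : ∀ x y → (x ∧ y) ′ ≈ x ′ ∨ y ′
    ∨-′′          : ∀ x y → (x ∨ y) ′ ′ ≈ x ′ ′ ∨ y ′ ′
    ′′-≤          : ∀ x → x ′ ′ ≤ x

DQD : Pred (Algebra c ℓ) (c ⊔ ℓ)
DQD = IsDQD

DSt : Pred (Algebra c ℓ) (c ⊔ ℓ)
DSt L = L ∈ DQD × (∀ x → x ′ ∧ x ′ ′ ≈ 0#)
  where open Algebra L

JID : Pred (Algebra c ℓ) (c ⊔ ℓ)
JID L = L ∈ DQD × (∀ x y z → x ′ ∨ (y ⇒ z) ≈ (x ′ ∨ y) ⇒ (x ′ ∨ z))
  where open Algebra L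

JID₁ : Pred (Algebra c ℓ) (c ⊔ ℓ)
JID₁ L = L ∈ JID × (∀ x → x ∧ x ′ * ≈ (x ∧ x ′ *) ′ *)
  where open Algebra L

-- |L| > 2
MoreThanTwo : Pred (Algebra c ℓ) (c ⊔ ℓ)
MoreThanTwo L = ∃[ x ] ∃[ y ] ∃[ z ] (¬ x ≈ y × ¬ x ≈ z × ¬ y ≈ z)
  where open Algebra L

MeetCondition : Pred (Algebra c ℓ) (c ⊔ ℓ)
MeetCondition L = ∀ x → ¬ x ≈ 1# → x ∧ (x ′) * ≈ 0#
  where open Algebra L

record IsHomomorphism (A : Algebra c₁ ℓ₁) (B : Algebra c₂ ℓ₂)
                      (f : Algebra.Carrier A → Algebra.Carrier B) :
                      Set (c₁ ⊔ ℓ₁ ⊔ ℓ₂) where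
  private
    module A = Algebra A
    module B = Algebra B
  field
    ≈-cong : Congruent A._≈_ B._≈_ f
    ∨-homo : Homomorphic₂ A.Carrier B.Carrier B._≈_ f A._∨_ B._∨_
    ∧-homo : Homomorphic₂ A.Carrier B.Carrier B._≈_ f A._∧_ B._∧_
    ⇒-homo : Homomorphic₂ A.Carrier B.Carrier B._≈_ f A._⇒_ B._⇒_
    ′-homo : Homomorphic₁ A.Carrier B.Carrier B._≈_ f A._′ B._′
    0-homo : Homomorphic₀ A.Carrier B.Carrier B._≈_ f A.0# B.0#
    1-homo : Homomorphic₀ A.Carrier B.Carrier B._≈_ f A.1# B.1#

IsIsomorphism : (A : Algebra c₁ ℓ₁) (B : Algebra c₂ ℓ₂) →
                (Algebra.Carrier A → Algebra.Carrier B) → Set (c₁ ⊔ ℓ₁ ⊔ c₂ ⊔ ℓ₂)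
IsIsomorphism A B f =
  IsHomomorphism A B f × Bijective (Algebra._≈_ A) (Algebra._≈_ B) f

infix 4 _≅_

_≅_ : Algebra c₁ ℓ₁ → Algebra c₂ ℓ₂ → Set (c₁ ⊔ ℓ₁ ⊔ c₂ ⊔ ℓ₂)
A ≅ B = ∃[ f ] IsIsomorphism A B f

record IsCongruence (L : Algebra c ℓ) (θ : Rel (Algebra.Carrier L) ℓ₁) :
                    Set (c ⊔ ℓ ⊔ ℓ₁) where
  open Algebra L using (_≈_; _∨_; _∧_; _⇒_; _′)
  field
    isEquivalence : IsEquivalence θ
    reflexive-≈   : ∀ {x y} → x ≈ y → θ x y
    ∨-compatible  : Congruent₂ θ _∨_
    ∧-compatible  : Congruent₂ θ _∧_
    ⇒-compatible  : Congruent₂ θ _⇒_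
    ′-compatible  : Congruent₁ θ _′

-- Every congruence is the identity congruence or the full congruence.
Simple : Algebra c ℓ → Set (suc (c ⊔ ℓ))
Simple {c} {ℓ} L = (θ : Rel Carrier (c ⊔ ℓ)) → IsCongruence L θ →
                   (∀ x y → θ x y → x ≈ y) ⊎ (∀ x y → θ x y)
  where open Algebra L

Π : (I : Set c₁) → (I → Algebra c ℓ) → Algebra (c₁ ⊔ c) (c₁ ⊔ ℓ)
Π I A = record
  { Carrier       = ∀ i → A.Carrier i
  ; _≈_           = λ x y → ∀ i → A._≈_ i (x i) (y i)
  ; _∨_           = λ x y i → A._∨_ i (x i) (y i)
  ; _∧_           = λ x y i → A._∧_ i (x i) (y i)
  ; _⇒_           = λ x y i → A._⇒_ i (x i) (y i)
  ; _′            = λ x i → A._′ i (x i)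
  ; 0#            = λ i → A.0# i
  ; 1#            = λ i → A.1# i
  ; isEquivalence = record
    { refl  = λ i → IsEquivalence.refl (A.isEquivalence i)
    ; sym   = λ p i → IsEquivalence.sym (A.isEquivalence i) (p i)
    ; trans = λ p q i → IsEquivalence.trans (A.isEquivalence i) (p i) (q i)
    }
  ; ∨-cong        = λ p q i → A.∨-cong i (p i) (q i)
  ; ∧-cong        = λ p q i → A.∧-cong i (p i) (q i)
  ; ⇒-cong        = λ p q i → A.⇒-cong i (p i) (q i)
  ; ′-cong        = λ p i → A.′-cong i (p i)
  }
  where module A i = Algebra (A i)

π : {I : Set c₁} (A : I → Algebra c ℓ) (i : I) →
    Algebra.Carrier (Π I A) → Algebra.Carrier (A i)
π A i x = x i

record IsSubdirectEmbedding (L : Algebra c₂ ℓ₂) {I : Set c₁} (A : I → Algebra c ℓ)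
                            (α : Algebra.Carrier L → Algebra.Carrier (Π I A)) :
                            Set (c ⊔ ℓ ⊔ c₁ ⊔ c₂ ⊔ ℓ₂) where
  field
    isHomomorphism : IsHomomorphism L (Π I A) α
    injective      : Injective (Algebra._≈_ L) (Algebra._≈_ (Π I A)) α
    surjective     : ∀ i → Surjective (Algebra._≈_ L) (Algebra._≈_ (A i)) (π A i ∘ α)

-- In every subdirect embedding, some coordinate map is an isomorphism.  The
-- factors of a subdirect embedding are homomorphic images of L and need at
-- most one index per pair of elements of L, which is why these universe
-- levels suffice.
SubdirectlyIrreducible : Algebra c ℓ → Set (suc (c ⊔ ℓ))
SubdirectlyIrreducible {c} {ℓ} L =
  (I : Set (c ⊔ ℓ)) (A : I → Algebra c ℓ)
  (α : Algebra.Carrier L → Algebra.Carrier (Π I A)) →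
  IsSubdirectEmbedding L A α →
  ∃[ i ] IsIsomorphism L (A i) (π A i ∘ α)

data Four : Set where
  𝟎 𝟏 𝐚 𝐛 : Four

_⊔₄_ : Op₂ Four
𝟎 ⊔₄ y = y
𝟏 ⊔₄ y = 𝟏
𝐚 ⊔₄ 𝟎 = 𝐚
𝐚 ⊔₄ 𝟏 = 𝟏
𝐚 ⊔₄ 𝐚 = 𝐚
𝐚 ⊔₄ 𝐛 = 𝟏
𝐛 ⊔₄ 𝟎 = 𝐛
𝐛 ⊔₄ 𝟏 = 𝟏
𝐛 ⊔₄ 𝐚 = 𝟏
𝐛 ⊔₄ 𝐛 = 𝐛

_⊓₄_ : Op₂ Four
𝟎 ⊓₄ y = 𝟎
𝟏 ⊓₄ y = y
𝐚 ⊓₄ 𝟎 = 𝟎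
𝐚 ⊓₄ 𝟏 = 𝐚
𝐚 ⊓₄ 𝐚 = 𝐚
𝐚 ⊓₄ 𝐛 = 𝟎
𝐛 ⊓₄ 𝟎 = 𝟎
𝐛 ⊓₄ 𝟏 = 𝐛
𝐛 ⊓₄ 𝐚 = 𝟎
𝐛 ⊓₄ 𝐛 = 𝐛

neg₄ : Op₁ Four
neg₄ 𝟎 = 𝟏
neg₄ 𝟏 = 𝟎
neg₄ 𝐚 = 𝐚
neg₄ 𝐛 = 𝐛

-- row p q r s is the function 𝟎 ↦ p, 𝟏 ↦ q, 𝐚 ↦ r, 𝐛 ↦ s.
row : Four → Four → Four → Four → Op₁ Four
row p q r s 𝟎 = p
row p q r s 𝟏 = q
row p q r s 𝐚 = r
row p q r s 𝐛 = s

imp₁ imp₂ imp₃ : Op₂ Four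

imp₁ 𝟎 = row 𝟏 𝟎 𝐛 𝐚
imp₁ 𝟏 = row 𝟎 𝟏 𝐚 𝐛
imp₁ 𝐚 = row 𝐛 𝐚 𝟏 𝟎
imp₁ 𝐛 = row 𝐚 𝐛 𝟎 𝟏

imp₂ 𝟎 = row 𝟏 𝟏 𝟏 𝟏
imp₂ 𝟏 = row 𝟎 𝟏 𝐚 𝐛
imp₂ 𝐚 = row 𝐛 𝟏 𝟏 𝐛
imp₂ 𝐛 = row 𝐚 𝟏 𝐚 𝟏

imp₃ 𝟎 = row 𝟏 𝐚 𝟏 𝐚
imp₃ 𝟏 = row 𝟎 𝟏 𝐚 𝐛
imp₃ 𝐚 = row 𝐛 𝐚 𝟏 𝟎
imp₃ 𝐛 = row 𝐚 𝟏 𝐚 𝟏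

fourElement : Op₂ Four → Algebra 0ℓ 0ℓ
fourElement imp = record
  { Carrier       = Four
  ; _≈_           = _≡_
  ; _∨_           = _⊔₄_
  ; _∧_           = _⊓₄_
  ; _⇒_           = imp
  ; _′            = neg₄
  ; 0#            = 𝟎
  ; 1#            = 𝟏
  ; isEquivalence = ≡.isEquivalence
  ; ∨-cong        = ≡.cong₂ _⊔₄_
  ; ∧-cong        = ≡.cong₂ _⊓₄_
  ; ⇒-cong        = ≡.cong₂ imp
  ; ′-cong        = ≡.cong neg₄
  }

D₁ D₂ D₃ : Algebra 0ℓ 0ℓ
D₁ = fourElement imp₁
D₂ = fourElement imp₂
D₃ = fourElement imp₃

{-# OPTIONS --safe #-}
module Submission where

-- The argument runs (b) ⟹ (a) ⟹ (c) ⟹ (b) and (c) ⟺ (d).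
--
-- (b) ⟹ (a).  The kernels of the coordinate maps of a subdirect embedding are
-- congruences.  If all of them were full, L would be trivial, so by simplicity
-- some coordinate map is injective.
--
-- (a) ⟹ (c).  By the identity defining JID₁, y = x ∧ x′* satisfies y ≈ y′*;
-- hence y ∧ y′ ≈ 0, and JID gives y ∨ y′ ≈ 1.  For p ∈ {y , y′} the relation
-- p ∧ s ≈ p ∧ t is a congruence (agreeOn-isCongruence), and the two of them
-- intersect in the identity.  Subdirect irreducibility makes one of them the
-- identity (SI⇒∩-irreducible): then y ≈ 1 or y ≈ 0, and y ≈ 1 forces x ≈ 1.
--
-- (c) ⟹ (b).  If a congruence identifies s ≉ t, then it identifies s ⇒ t and
-- t ⇒ s with 1, and one of these elements is not 1.  For such an element x
-- the congruence also identifies x ∧ x′* ≈ 0 with 1, so it is full.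
--
-- (c) ⟹ (d).  JID gives z′ ∨ z′* ≈ 1, so the condition z ∧ z′* ≈ 0 for z ≉ 1
-- yields z ≤ z′ for every z ≉ 1.  If L is not in DSt, pick w = x′ with
-- w ∧ w′ ≉ 0.  Then w and its complement w* are fixed by ′, and each z ≉ 1
-- satisfies z ≤ v or z ∨ v ≈ 1 for v either of the two.  Hence
-- L = {0 , 1 , w , w*}.  On complemented elements ⇒ is determined by the
-- lattice operations and the element 0 ⇒ 1 (⇒-by-complements); the four
-- values of 0 ⇒ 1 yield D₁, D₂, D₃ and D₃ with the atoms interchanged.
--
-- (d) ⟹ (c).  The laws are checked on D₁, D₂, D₃ by evaluation and pulled
-- back along an injective homomorphism.  In DSt the condition on x ∧ x′*
-- forces x′ ∈ {0 , 1}, which makes the identity defining JID immediate.  In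
-- either case the identity defining JID₁ follows from that condition
-- (levelLaw).

open import Defs
open import Axiom.ExcludedMiddle using (ExcludedMiddle)
open import Data.Product using (_×_)
open import Data.Sum using (_⊎_)
open import Function.Bundles using (_⇔_)
open import Level using (Level; _⊔_)
open import Relation.Unary using (_∈_)

open import Algebra.Lattice.Bundles using (Lattice)
import Algebra.Lattice.Properties.Lattice as LatticeProperties
open import Algebra.Lattice.Structures using (IsLattice)
open import Data.Bool.Base using (Bool; true; false)
open import Data.Empty using (⊥-elim)
open import Data.Fin.Base using (Fin; zero; suc)
import Data.Fin.Properties as Fin
open import Data.Product using (_,_; proj₁; proj₂; ∃-syntax)
open import Data.Sum using (inj₁; inj₂)
open import Function.Base using (_∘_)
open import Function.Bundles using (mk⇔)
open import Level using (Lift; lift; lower)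
open import Relation.Binary.Bundles using (Setoid)
open import Relation.Binary.Core using (Rel)
open import Relation.Binary.Definitions using (DecidableEquality)
open import Relation.Binary.Lattice using (HeytingAlgebra)
import Relation.Binary.Lattice.Properties.DistributiveLattice as DistributiveProperties
import Relation.Binary.Lattice.Properties.HeytingAlgebra as HeytingProperties
open import Relation.Binary.PropositionalEquality as ≡ using (_≡_)
import Relation.Binary.Reasoning.Setoid as SetoidReasoning
open import Relation.Binary.Structures using (IsEquivalence)
open import Relation.Nullary using (¬_; Dec; yes; no)
open import Relation.Nullary.Decidable
  using (map′; from-yes; ¬?; _×-dec_; _→-dec_; decidable-stable)
open import Relation.Unary using (Pred; Decidable)

private
  variable
    c ℓ c₁ ℓ₁ : Level

-- Semi-Heyting algebras

algebraSetoid : Algebra c ℓ → Setoid c ℓ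
algebraSetoid L = record { isEquivalence = Algebra.isEquivalence L }

module SemiHeyting (L : Algebra c ℓ) (isSemiHeyting : IsSemiHeyting L) where
  open Algebra L
  open IsSemiHeyting isSemiHeyting public
  open IsLattice isLattice public
    hiding (isEquivalence; ∨-cong; ∧-cong)

  lattice : Lattice c ℓ
  lattice = record { isLattice = isLattice }

  open LatticeProperties lattice public
    using (∧-idem; ∨-idem; ∨-∧-isOrderTheoreticLattice)

  setoid : Setoid c ℓ
  setoid = algebraSetoid L

  open SetoidReasoning setoid

  ∧-zeroˡ : ∀ x → 0# ∧ x ≈ 0#
  ∧-zeroˡ = proj₁ ∧-zero

  ∧-zeroʳ : ∀ x → x ∧ 0# ≈ 0#
  ∧-zeroʳ = proj₂ ∧-zero

  ∨-zeroˡ : ∀ x → 1# ∨ x ≈ 1#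
  ∨-zeroˡ = proj₁ ∨-zero

  ∨-zeroʳ : ∀ x → x ∨ 1# ≈ 1#
  ∨-zeroʳ = proj₂ ∨-zero

  ∧-identityʳ : ∀ x → x ∧ 1# ≈ x
  ∧-identityʳ x = trans (∧-congˡ (sym (∨-zeroʳ x))) (∧-absorbs-∨ x 1#)

  ∧-identityˡ : ∀ x → 1# ∧ x ≈ x
  ∧-identityˡ x = trans (∧-comm 1# x) (∧-identityʳ x)

  ∨-identityʳ : ∀ x → x ∨ 0# ≈ x
  ∨-identityʳ x = trans (∨-congˡ (sym (∧-zeroʳ x))) (∨-absorbs-∧ x 0#)

  ∨-identityˡ : ∀ x → 0# ∨ x ≈ x
  ∨-identityˡ x = trans (∨-comm 0# x) (∨-identityʳ x)

  ≤-antisym : ∀ {x y} → x ≤ y → y ≤ x → x ≈ y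
  ≤-antisym {x} {y} x≤y y≤x = trans (sym x≤y) (trans (∧-comm x y) y≤x)

  ≤-trans : ∀ {x y z} → x ≤ y → y ≤ z → x ≤ z
  ≤-trans {x} {y} {z} x≤y y≤z = begin
    x ∧ z        ≈⟨ ∧-congʳ x≤y ⟨
    (x ∧ y) ∧ z  ≈⟨ ∧-assoc x y z ⟩
    x ∧ (y ∧ z)  ≈⟨ ∧-congˡ y≤z ⟩
    x ∧ y        ≈⟨ x≤y ⟩
    x            ∎

  ≤-respʳ : ∀ {x y z} → y ≈ z → x ≤ y → x ≤ z
  ≤-respʳ y≈z x≤y = trans (∧-congˡ (sym y≈z)) x≤y

  x≤x∨y : ∀ x y → x ≤ x ∨ y
  x≤x∨y = ∧-absorbs-∨

  -- The term x ⇒ (x ∧ y) is a relative pseudocomplement, so the lattice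
  -- reduct is that of a Heyting algebra; distributivity follows.  The order
  -- used here is the natural one, with x below y when x ≈ x ∧ y.
  heytingAlgebra : HeytingAlgebra c ℓ ℓ
  heytingAlgebra = record
    { _⇨_ = λ x y → x ⇒ (x ∧ y)
    ; ⊤   = 1#
    ; ⊥   = 0#
    ; isHeytingAlgebra = record
      { isBoundedLattice = record
        { isLattice = ∨-∧-isOrderTheoreticLattice
        ; maximum   = λ x → sym (∧-identityʳ x)
        ; minimum   = λ x → sym (∧-zeroˡ x)
        }
      ; exponential = λ w x y → transpose w x y , untranspose w x y
      }
    }
    where
    transpose : ∀ w x y → w ∧ x ≈ (w ∧ x) ∧ y → w ≈ w ∧ (x ⇒ (x ∧ y))
    transpose w x y w∧x≤y = sym (begin
      w ∧ (x ⇒ (x ∧ y))                    ≈⟨ ∧-⇒-∧ w x (x ∧ y) ⟩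
      w ∧ ((w ∧ x) ⇒ (w ∧ (x ∧ y)))        ≈⟨ ∧-congˡ (⇒-cong refl (∧-assoc w x y)) ⟨
      w ∧ ((w ∧ x) ⇒ ((w ∧ x) ∧ y))        ≈⟨ ∧-congˡ (⇒-cong refl w∧x≤y) ⟨
      w ∧ ((w ∧ x) ⇒ (w ∧ x))              ≈⟨ ∧-congˡ (⇒-refl (w ∧ x)) ⟩
      w ∧ 1#                               ≈⟨ ∧-identityʳ w ⟩
      w                                    ∎)

    untranspose : ∀ w x y → w ≈ w ∧ (x ⇒ (x ∧ y)) → w ∧ x ≈ (w ∧ x) ∧ y
    untranspose w x y w≤x⇨y = begin
      w ∧ x                          ≈⟨ ∧-congʳ w≤x⇨y ⟩
      (w ∧ (x ⇒ (x ∧ y))) ∧ x        ≈⟨ ∧-assoc w _ x ⟩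
      w ∧ ((x ⇒ (x ∧ y)) ∧ x)        ≈⟨ ∧-congˡ (∧-comm _ x) ⟩
      w ∧ (x ∧ (x ⇒ (x ∧ y)))        ≈⟨ ∧-congˡ (∧-⇒ x (x ∧ y)) ⟩
      w ∧ (x ∧ (x ∧ y))              ≈⟨ ∧-congˡ (∧-assoc x x y) ⟨
      w ∧ ((x ∧ x) ∧ y)              ≈⟨ ∧-congˡ (∧-congʳ (∧-idem x)) ⟩
      w ∧ (x ∧ y)                    ≈⟨ ∧-assoc w x y ⟨
      (w ∧ x) ∧ y                    ∎

  open HeytingProperties heytingAlgebra public using (∧-distribˡ-∨)
  open DistributiveProperties
    (HeytingProperties.distributiveLattice heytingAlgebra) public
    using (∧-distribʳ-∨)

  split : ∀ {p q} → p ∨ q ≈ 1# → ∀ x → x ≈ (p ∧ x) ∨ (q ∧ x)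
  split {p} {q} p∨q≈1 x = begin
    x                  ≈⟨ ∧-identityˡ x ⟨
    1# ∧ x             ≈⟨ ∧-congʳ p∨q≈1 ⟨
    (p ∨ q) ∧ x        ≈⟨ ∧-distribʳ-∨ x p q ⟩
    (p ∧ x) ∨ (q ∧ x)  ∎

  separate : ∀ {p q x y} → p ∨ q ≈ 1# → p ∧ x ≈ p ∧ y → q ∧ x ≈ q ∧ y → x ≈ y
  separate p∨q≈1 px≈py qx≈qy =
    trans (split p∨q≈1 _) (trans (∨-cong px≈py qx≈qy) (sym (split p∨q≈1 _)))

  -- The part of x below q vanishes, so x lies below p.
  cover⇒≤ : ∀ {p q x} → p ∨ q ≈ 1# → x ∧ q ≈ 0# → x ≤ p
  cover⇒≤ {p} {q} {x} p∨q≈1 x∧q≈0 = begin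
    x ∧ p              ≈⟨ ∨-identityʳ (x ∧ p) ⟨
    (x ∧ p) ∨ 0#       ≈⟨ ∨-congˡ x∧q≈0 ⟨
    (x ∧ p) ∨ (x ∧ q)  ≈⟨ ∧-distribˡ-∨ x p q ⟨
    x ∧ (p ∨ q)        ≈⟨ ∧-congˡ p∨q≈1 ⟩
    x ∧ 1#             ≈⟨ ∧-identityʳ x ⟩
    x                  ∎

  x∧x*≈0 : ∀ x → x ∧ x * ≈ 0#
  x∧x*≈0 x = trans (∧-⇒ x 0#) (∧-zeroʳ x)

  0*≈1 : 0# * ≈ 1#
  0*≈1 = ⇒-refl 0#

  1*≈0 : 1# * ≈ 0#
  1*≈0 = trans (sym (∧-identityˡ (1# *))) (x∧x*≈0 1#)

  disjoint⇒≤* : ∀ {x y} → x ∧ y ≈ 0# → x ≤ y *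
  disjoint⇒≤* {x} {y} x∧y≈0 = begin
    x ∧ (y ⇒ 0#)                ≈⟨ ∧-⇒-∧ x y 0# ⟩
    x ∧ ((x ∧ y) ⇒ (x ∧ 0#))    ≈⟨ ∧-congˡ (⇒-cong x∧y≈0 (∧-zeroʳ x)) ⟩
    x ∧ (0# ⇒ 0#)               ≈⟨ ∧-congˡ 0*≈1 ⟩
    x ∧ 1#                      ≈⟨ ∧-identityʳ x ⟩
    x                           ∎

  ⇒≈1⇒≤ : ∀ {x y} → x ⇒ y ≈ 1# → x ≤ y
  ⇒≈1⇒≤ {x} {y} x⇒y≈1 = begin
    x ∧ y        ≈⟨ ∧-⇒ x y ⟨
    x ∧ (x ⇒ y)  ≈⟨ ∧-congˡ x⇒y≈1 ⟩
    x ∧ 1#       ≈⟨ ∧-identityʳ x ⟩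
    x            ∎

  0⇒-by-complement : ∀ {z z̄} → z ∨ z̄ ≈ 1# → z ∧ z̄ ≈ 0# →
                     0# ⇒ z ≈ (z ∧ (0# ⇒ 1#)) ∨ z̄
  0⇒-by-complement {z} {z̄} z∨z̄≈1 z∧z̄≈0 =
    trans (split z∨z̄≈1 (0# ⇒ z)) (∨-cong on-z on-z̄)
    where
    on-z : z ∧ (0# ⇒ z) ≈ z ∧ (0# ⇒ 1#)
    on-z = begin
      z ∧ (0# ⇒ z)                ≈⟨ ∧-⇒-∧ z 0# z ⟩
      z ∧ ((z ∧ 0#) ⇒ (z ∧ z))    ≈⟨ ∧-congˡ (⇒-cong refl (trans (∧-idem z) (sym (∧-identityʳ z)))) ⟩
      z ∧ ((z ∧ 0#) ⇒ (z ∧ 1#))   ≈⟨ ∧-⇒-∧ z 0# 1# ⟨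
      z ∧ (0# ⇒ 1#)               ∎

    on-z̄ : z̄ ∧ (0# ⇒ z) ≈ z̄
    on-z̄ = begin
      z̄ ∧ (0# ⇒ z)                ≈⟨ ∧-⇒-∧ z̄ 0# z ⟩
      z̄ ∧ ((z̄ ∧ 0#) ⇒ (z̄ ∧ z))    ≈⟨ ∧-congˡ (⇒-cong (∧-zeroʳ z̄) (trans (∧-comm z̄ z) z∧z̄≈0)) ⟩
      z̄ ∧ (0# ⇒ 0#)               ≈⟨ ∧-congˡ 0*≈1 ⟩
      z̄ ∧ 1#                      ≈⟨ ∧-identityʳ z̄ ⟩
      z̄                           ∎

  -- On complemented elements ⇒ depends only on the lattice and on 0 ⇒ 1.
  ⇒-by-complements : ∀ {y ȳ z z̄} →
                     y ∨ ȳ ≈ 1# → y ∧ ȳ ≈ 0# → z ∨ z̄ ≈ 1# → z ∧ z̄ ≈ 0# →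
                     y ⇒ z ≈ (y ∧ z) ∨ (ȳ ∧ ((z ∧ (0# ⇒ 1#)) ∨ z̄))
  ⇒-by-complements {y} {ȳ} {z} {z̄} y∨ȳ≈1 y∧ȳ≈0 z∨z̄≈1 z∧z̄≈0 = begin
    y ⇒ z                                        ≈⟨ split y∨ȳ≈1 (y ⇒ z) ⟩
    (y ∧ (y ⇒ z)) ∨ (ȳ ∧ (y ⇒ z))                ≈⟨ ∨-cong (∧-⇒ y z) on-ȳ ⟩
    (y ∧ z) ∨ (ȳ ∧ (0# ⇒ z))                     ≈⟨ ∨-congˡ (∧-congˡ (0⇒-by-complement z∨z̄≈1 z∧z̄≈0)) ⟩
    (y ∧ z) ∨ (ȳ ∧ ((z ∧ (0# ⇒ 1#)) ∨ z̄))        ∎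
    where
    on-ȳ : ȳ ∧ (y ⇒ z) ≈ ȳ ∧ (0# ⇒ z)
    on-ȳ = begin
      ȳ ∧ (y ⇒ z)                 ≈⟨ ∧-⇒-∧ ȳ y z ⟩
      ȳ ∧ ((ȳ ∧ y) ⇒ (ȳ ∧ z))     ≈⟨ ∧-congˡ (⇒-cong (trans (∧-comm ȳ y) (trans y∧ȳ≈0 (sym (∧-zeroʳ ȳ)))) refl) ⟩
      ȳ ∧ ((ȳ ∧ 0#) ⇒ (ȳ ∧ z))    ≈⟨ ∧-⇒-∧ ȳ 0# z ⟨
      ȳ ∧ (0# ⇒ z)                ∎

-- The laws defining JID and JID₁ inside DQD

JoinLaw : Pred (Algebra c ℓ) _
JoinLaw L = ∀ x y z → x ′ ∨ (y ⇒ z) ≈ (x ′ ∨ y) ⇒ (x ′ ∨ z)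
  where open Algebra L

LevelLaw : Pred (Algebra c ℓ) _
LevelLaw L = ∀ x → x ∧ x ′ * ≈ (x ∧ x ′ *) ′ *
  where open Algebra L

-- Dually quasi-De Morgan semi-Heyting algebras

module DQDProperties (L : Algebra c ℓ) (isDQD : IsDQD L) where
  open Algebra L
  open IsDQD isDQD public
  open SemiHeyting L isSemiHeyting public
  open SetoidReasoning setoid

  ′-antitone : ∀ {x y} → x ≤ y → y ′ ≤ x ′
  ′-antitone {x} {y} x≤y = begin
    y ′ ∧ x ′          ≈⟨ ∧-congˡ (′-cong x≤y) ⟨
    y ′ ∧ (x ∧ y) ′    ≈⟨ ∧-congˡ (∧-′ x y) ⟩
    y ′ ∧ (x ′ ∨ y ′)  ≈⟨ ∧-congˡ (∨-comm (x ′) (y ′)) ⟩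
    y ′ ∧ (y ′ ∨ x ′)  ≈⟨ ∧-absorbs-∨ (y ′) (x ′) ⟩
    y ′                ∎

  ′′′≈′ : ∀ x → x ′ ′ ′ ≈ x ′
  ′′′≈′ x = ≤-antisym (′′-≤ (x ′)) (′-antitone (′′-≤ x))

  disjoint⇒′-cover : ∀ {x y} → x ∧ y ≈ 0# → x ′ ∨ y ′ ≈ 1#
  disjoint⇒′-cover {x} {y} x∧y≈0 =
    trans (sym (∧-′ x y)) (trans (′-cong x∧y≈0) 0′≈1)

  0′*≈0 : 0# ′ * ≈ 0#
  0′*≈0 = trans (⇒-cong 0′≈1 refl) 1*≈0

  1′*≈1 : 1# ′ * ≈ 1#
  1′*≈1 = trans (⇒-cong 1′≈0 refl) 0*≈1

  joinLaw⇒′-cover : JoinLaw L → ∀ x → x ′ ∨ x ′ * ≈ 1#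
  joinLaw⇒′-cover join x = begin
    x ′ ∨ (x ′ ⇒ 0#)             ≈⟨ join x (x ′) 0# ⟩
    (x ′ ∨ x ′) ⇒ (x ′ ∨ 0#)     ≈⟨ ⇒-cong (∨-idem (x ′)) (∨-identityʳ (x ′)) ⟩
    x ′ ⇒ x ′                    ≈⟨ ⇒-refl (x ′) ⟩
    1#                           ∎

  ′-complement⇒′′≈ : ∀ {y} → y ∧ y ′ ≈ 0# → y ′ ′ ≈ y
  ′-complement⇒′′≈ {y} y∧y′≈0 =
    ≤-antisym (′′-≤ y)
      (cover⇒≤ (trans (∨-comm _ _) (disjoint⇒′-cover y∧y′≈0)) y∧y′≈0)

-- Congruences and subdirect irreducibility

-- The carrier is unchanged; the congruence becomes the equality.
quotient : (L : Algebra c ℓ) {θ : Rel (Algebra.Carrier L) ℓ} →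
           IsCongruence L θ → Algebra c ℓ
quotient L {θ} θ-cong = record
  { Carrier       = Carrier
  ; _≈_           = θ
  ; _∨_           = _∨_
  ; _∧_           = _∧_
  ; _⇒_           = _⇒_
  ; _′            = _′
  ; 0#            = 0#
  ; 1#            = 1#
  ; isEquivalence = C.isEquivalence
  ; ∨-cong        = C.∨-compatible
  ; ∧-cong        = C.∧-compatible
  ; ⇒-cong        = C.⇒-compatible
  ; ′-cong        = C.′-compatible
  }
  where
  open Algebra L
  module C = IsCongruence θ-cong

-- If two congruences of a subdirectly irreducible algebra intersect in the
-- identity, then one of them is the identity: the algebra embeds subdirectly
-- in the product of the two quotients.
SI⇒∩-irreducible : (L : Algebra c ℓ) → SubdirectlyIrreducible L →
                   let open Algebra L in
                   {θ φ : Rel Carrier ℓ} → IsCongruence L θ → IsCongruence L φ →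
                   (∀ {x y} → θ x y → φ x y → x ≈ y) →
                   (∀ {x y} → θ x y → x ≈ y) ⊎ (∀ {x y} → φ x y → x ≈ y)
SI⇒∩-irreducible {c} {ℓ} L si {θ} {φ} θ-cong φ-cong θ∩φ⊆≈ =
  trivial-coordinate (si (Lift (c ⊔ ℓ) Bool) factor diagonal subdirect)
  where
  open Algebra L

  factor : Lift (c ⊔ ℓ) Bool → Algebra c ℓ
  factor (lift true)  = quotient L θ-cong
  factor (lift false) = quotient L φ-cong

  diagonal : Carrier → Algebra.Carrier (Π _ factor)
  diagonal x (lift true)  = x
  diagonal x (lift false) = x

  from-≈ : ∀ {x y} → x ≈ y → Algebra._≈_ (Π _ factor) (diagonal x) (diagonal y)
  from-≈ x≈y (lift true)  = IsCongruence.reflexive-≈ θ-cong x≈y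
  from-≈ x≈y (lift false) = IsCongruence.reflexive-≈ φ-cong x≈y

  subdirect : IsSubdirectEmbedding L factor diagonal
  subdirect = record
    { isHomomorphism = record
      { ≈-cong = from-≈
      ; ∨-homo = λ { x y (lift true) → θ-refl ; x y (lift false) → φ-refl }
      ; ∧-homo = λ { x y (lift true) → θ-refl ; x y (lift false) → φ-refl }
      ; ⇒-homo = λ { x y (lift true) → θ-refl ; x y (lift false) → φ-refl }
      ; ′-homo = λ { x (lift true) → θ-refl ; x (lift false) → φ-refl }
      ; 0-homo = λ { (lift true) → θ-refl ; (lift false) → φ-refl }
      ; 1-homo = λ { (lift true) → θ-refl ; (lift false) → φ-refl }
      }
    ; injective  = λ eq → θ∩φ⊆≈ (eq (lift true)) (eq (lift false))
    ; surjective = λ { (lift true)  y → y , IsCongruence.reflexive-≈ θ-cong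
                     ; (lift false) y → y , IsCongruence.reflexive-≈ φ-cong }
    }
    where
    open IsEquivalence (IsCongruence.isEquivalence θ-cong)
      renaming (refl to θ-refl) using ()
    open IsEquivalence (IsCongruence.isEquivalence φ-cong)
      renaming (refl to φ-refl) using ()

  trivial-coordinate : ∃[ i ] IsIsomorphism L (factor i) (π factor i ∘ diagonal) →
                       (∀ {x y} → θ x y → x ≈ y) ⊎ (∀ {x y} → φ x y → x ≈ y)
  trivial-coordinate (lift true  , _ , injective , _) = inj₁ injective
  trivial-coordinate (lift false , _ , injective , _) = inj₂ injective

-- The relation of having the same meet with p.
agreeOn : (L : Algebra c ℓ) → Algebra.Carrier L → Rel (Algebra.Carrier L) ℓ
agreeOn L p x y = p ∧ x ≈ p ∧ y
  where open Algebra L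

-- The hypothesis on p is used only for compatibility with ′, where it removes
-- p ′ from (p ∧ x) ′ ≈ p ′ ∨ x ′.
agreeOn-isCongruence : (L : Algebra c ℓ) → L ∈ DQD → let open Algebra L in
                       ∀ {p} → p ∧ p ′ ≈ 0# → IsCongruence L (agreeOn L p)
agreeOn-isCongruence L isDQD {p} p∧p′≈0 = record
  { isEquivalence = record { refl = refl ; sym = sym ; trans = trans }
  ; reflexive-≈   = ∧-congˡ
  ; ∨-compatible  = λ {x} {y} {u} {v} px≈py pu≈pv → begin
      p ∧ (x ∨ u)        ≈⟨ ∧-distribˡ-∨ p x u ⟩
      (p ∧ x) ∨ (p ∧ u)  ≈⟨ ∨-cong px≈py pu≈pv ⟩
      (p ∧ y) ∨ (p ∧ v)  ≈⟨ ∧-distribˡ-∨ p y v ⟨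
      p ∧ (y ∨ v)        ∎
  ; ∧-compatible  = λ {x} {y} {u} {v} px≈py pu≈pv → begin
      p ∧ (x ∧ u)  ≈⟨ ∧-assoc p x u ⟨
      (p ∧ x) ∧ u  ≈⟨ ∧-congʳ px≈py ⟩
      (p ∧ y) ∧ u  ≈⟨ ∧-congʳ (∧-comm p y) ⟩
      (y ∧ p) ∧ u  ≈⟨ ∧-assoc y p u ⟩
      y ∧ (p ∧ u)  ≈⟨ ∧-congˡ pu≈pv ⟩
      y ∧ (p ∧ v)  ≈⟨ ∧-assoc y p v ⟨
      (y ∧ p) ∧ v  ≈⟨ ∧-congʳ (∧-comm y p) ⟩
      (p ∧ y) ∧ v  ≈⟨ ∧-assoc p y v ⟩
      p ∧ (y ∧ v)  ∎
  ; ⇒-compatible  = λ {x} {y} {u} {v} px≈py pu≈pv → begin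
      p ∧ (x ⇒ u)              ≈⟨ ∧-⇒-∧ p x u ⟩
      p ∧ ((p ∧ x) ⇒ (p ∧ u))  ≈⟨ ∧-congˡ (⇒-cong px≈py pu≈pv) ⟩
      p ∧ ((p ∧ y) ⇒ (p ∧ v))  ≈⟨ ∧-⇒-∧ p y v ⟨
      p ∧ (y ⇒ v)              ∎
  ; ′-compatible  = λ {x} {y} px≈py → begin
      p ∧ x ′        ≈⟨ absorb x ⟨
      p ∧ (p ∧ x) ′  ≈⟨ ∧-congˡ (′-cong px≈py) ⟩
      p ∧ (p ∧ y) ′  ≈⟨ absorb y ⟩
      p ∧ y ′        ∎
  }
  where
  open Algebra L
  open DQDProperties L isDQD
  open SetoidReasoning setoid

  absorb : ∀ x → p ∧ (p ∧ x) ′ ≈ p ∧ x ′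
  absorb x = begin
    p ∧ (p ∧ x) ′            ≈⟨ ∧-congˡ (∧-′ p x) ⟩
    p ∧ (p ′ ∨ x ′)          ≈⟨ ∧-distribˡ-∨ p (p ′) (x ′) ⟩
    (p ∧ p ′) ∨ (p ∧ x ′)    ≈⟨ ∨-congʳ p∧p′≈0 ⟩
    0# ∨ (p ∧ x ′)           ≈⟨ ∨-identityˡ (p ∧ x ′) ⟩
    p ∧ x ′                  ∎

SI⇒meetCondition : (L : Algebra c ℓ) → L ∈ JID₁ →
                   SubdirectlyIrreducible L → MeetCondition L
SI⇒meetCondition L ((isDQD , join) , level) si x x≉1 =
  conclude (SI⇒∩-irreducible L si
              (agreeOn-isCongruence L isDQD y∧y′≈0)
              (agreeOn-isCongruence L isDQD y′∧y″≈0)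
              (separate y∨y′≈1))
  where
  open Algebra L
  open DQDProperties L isDQD
  open SetoidReasoning setoid

  y : Carrier
  y = x ∧ x ′ *

  y∧y′≈0 : y ∧ y ′ ≈ 0#
  y∧y′≈0 = begin
    y ∧ y ′      ≈⟨ ∧-comm y (y ′) ⟩
    y ′ ∧ y      ≈⟨ ∧-congˡ (level x) ⟩
    y ′ ∧ y ′ *  ≈⟨ x∧x*≈0 (y ′) ⟩
    0#           ∎

  y′∧y″≈0 : y ′ ∧ y ′ ′ ≈ 0#
  y′∧y″≈0 = begin
    y ′ ∧ y ′ ′  ≈⟨ ∧-congˡ (′-complement⇒′′≈ y∧y′≈0) ⟩
    y ′ ∧ y      ≈⟨ ∧-comm (y ′) y ⟩
    y ∧ y ′      ≈⟨ y∧y′≈0 ⟩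
    0#           ∎

  y∨y′≈1 : y ∨ y ′ ≈ 1#
  y∨y′≈1 = begin
    y ∨ y ′      ≈⟨ ∨-comm y (y ′) ⟩
    y ′ ∨ y      ≈⟨ ∨-congˡ (level x) ⟩
    y ′ ∨ y ′ *  ≈⟨ joinLaw⇒′-cover join y ⟩
    1#           ∎

  -- p and 1 agree on p, so p ≈ 1 as soon as agreeOn L p is the identity.
  p~1 : ∀ p → agreeOn L p p 1#
  p~1 p = trans (∧-idem p) (sym (∧-identityʳ p))

  conclude : (∀ {s t} → agreeOn L y s t → s ≈ t) ⊎
             (∀ {s t} → agreeOn L (y ′) s t → s ≈ t) → y ≈ 0#
  conclude (inj₁ trivial) = ⊥-elim (x≉1 (begin
    x                      ≈⟨ ∨-absorbs-∧ x (x ′ *) ⟨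
    x ∨ y                  ≈⟨ ∨-congˡ (trivial (p~1 y)) ⟩
    x ∨ 1#                 ≈⟨ ∨-zeroʳ x ⟩
    1#                     ∎))
  conclude (inj₂ trivial) = begin
    y        ≈⟨ ∧-identityʳ y ⟨
    y ∧ 1#   ≈⟨ ∧-congˡ (trivial (p~1 (y ′))) ⟨
    y ∧ y ′  ≈⟨ y∧y′≈0 ⟩
    0#       ∎

-- Simplicity

simple⇒SI : ExcludedMiddle (c ⊔ ℓ) → (L : Algebra c ℓ) → L ∈ MoreThanTwo →
            Simple L → SubdirectlyIrreducible L
simple⇒SI {c} {ℓ} em L (s , t , _ , s≉t , _) simple I A α embedding =
  conclude em
  where
  open Algebra L
  open IsSubdirectEmbedding embedding
  open IsHomomorphism isHomomorphism
  module A i = Algebra (A i)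
  module ≈ᵢ i = IsEquivalence (A.isEquivalence i)

  kernel : I → Rel Carrier (c ⊔ ℓ)
  kernel i x y = Lift c (A._≈_ i (α x i) (α y i))

  kernel-isCongruence : ∀ i → IsCongruence L (kernel i)
  kernel-isCongruence i = record
    { isEquivalence = record
      { refl  = lift refl
      ; sym   = λ p → lift (sym (lower p))
      ; trans = λ p q → lift (trans (lower p) (lower q))
      }
    ; reflexive-≈   = λ x≈y → lift (≈-cong x≈y i)
    ; ∨-compatible  = λ p q → lift (trans (∨-homo _ _ i)
                        (trans (A.∨-cong i (lower p) (lower q)) (sym (∨-homo _ _ i))))
    ; ∧-compatible  = λ p q → lift (trans (∧-homo _ _ i)
                        (trans (A.∧-cong i (lower p) (lower q)) (sym (∧-homo _ _ i))))
    ; ⇒-compatible  = λ p q → lift (trans (⇒-homo _ _ i)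
                        (trans (A.⇒-cong i (lower p) (lower q)) (sym (⇒-homo _ _ i))))
    ; ′-compatible  = λ p → lift (trans (′-homo _ i)
                        (trans (A.′-cong i (lower p)) (sym (′-homo _ i))))
    }
    where open ≈ᵢ i

  KernelTrivial : I → Set (c ⊔ ℓ)
  KernelTrivial i = ∀ x y → kernel i x y → x ≈ y

  isIsomorphism : ∀ i → KernelTrivial i → IsIsomorphism L (A i) (π A i ∘ α)
  isIsomorphism i trivial = record
    { ≈-cong = λ x≈y → ≈-cong x≈y i
    ; ∨-homo = λ x y → ∨-homo x y i
    ; ∧-homo = λ x y → ∧-homo x y i
    ; ⇒-homo = λ x y → ⇒-homo x y i
    ; ′-homo = λ x → ′-homo x i
    ; 0-homo = 0-homo i
    ; 1-homo = 1-homo i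
    } , (λ eq → trivial _ _ (lift eq)) , surjective i

  kernel-full : ¬ (∃[ i ] KernelTrivial i) → ∀ i → kernel i s t
  kernel-full none i with simple (kernel i) (kernel-isCongruence i)
  ... | inj₁ trivial = ⊥-elim (none (i , trivial))
  ... | inj₂ full    = full s t

  conclude : Dec (∃[ i ] KernelTrivial i) → ∃[ i ] IsIsomorphism L (A i) (π A i ∘ α)
  conclude (yes (i , trivial)) = i , isIsomorphism i trivial
  conclude (no none) = ⊥-elim (s≉t (injective (λ i → lower (kernel-full none i))))

meetCondition⇒simple : ExcludedMiddle (c ⊔ ℓ) → (L : Algebra c ℓ) → L ∈ DQD →
                       MeetCondition L → Simple L
meetCondition⇒simple {c} {ℓ} em L isDQD meet θ θ-cong = conclude em
  where
  open Algebra L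
  open DQDProperties L isDQD
  module θ = IsCongruence θ-cong
  module θ≡ = IsEquivalence θ.isEquivalence

  0~1⇒full : θ 0# 1# → ∀ x y → θ x y
  0~1⇒full 0~1 x y = θ≡.trans (~0 x) (θ≡.sym (~0 y))
    where
    ~0 : ∀ z → θ z 0#
    ~0 z = θ≡.trans (θ.reflexive-≈ (sym (∧-identityʳ z)))
          (θ≡.trans (θ.∧-compatible θ≡.refl (θ≡.sym 0~1))
                    (θ.reflexive-≈ (∧-zeroʳ z)))

  ~1⇒0~1 : ∀ {x} → ¬ x ≈ 1# → θ x 1# → θ 0# 1#
  ~1⇒0~1 {x} x≉1 x~1 =
    θ≡.trans (θ.reflexive-≈ (sym (meet x x≉1)))
    (θ≡.trans (θ.∧-compatible x~1 (θ.⇒-compatible (θ.′-compatible x~1) θ≡.refl))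
              (θ.reflexive-≈ (trans (∧-identityˡ (1# ′ *)) 1′*≈1)))

  ~⇒⇒~1 : ∀ {x y} → θ x y → θ (x ⇒ y) 1#
  ~⇒⇒~1 {x} {y} x~y =
    θ≡.trans (θ.⇒-compatible x~y θ≡.refl) (θ.reflexive-≈ (⇒-refl y))

  decide : (x y : Carrier) → Dec (x ≈ y)
  decide x y = map′ lower lift (em {P = Lift c (x ≈ y)})

  conclude : Dec (θ 0# 1#) → (∀ x y → θ x y → x ≈ y) ⊎ (∀ x y → θ x y)
  conclude (yes 0~1) = inj₂ (0~1⇒full 0~1)
  conclude (no 0≁1)  = inj₁ λ x y x~y →
    ≤-antisym (⇒≈1⇒≤ (~1⇒≈1 (~⇒⇒~1 x~y))) (⇒≈1⇒≤ (~1⇒≈1 (~⇒⇒~1 (θ≡.sym x~y))))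
    where
    ~1⇒≈1 : ∀ {x} → θ x 1# → x ≈ 1#
    ~1⇒≈1 {x} x~1 = decidable-stable (decide x 1#) λ x≉1 → 0≁1 (~1⇒0~1 x≉1 x~1)

-- Transfer along homomorphisms

module _ {A : Algebra c ℓ} {B : Algebra c₁ ℓ₁}
         {f : Algebra.Carrier A → Algebra.Carrier B}
         (f-isHomomorphism : IsHomomorphism A B f)
         (f-injective : ∀ {x y} → Algebra._≈_ B (f x) (f y) → Algebra._≈_ A x y)
  where
  private
    module A = Algebra A
    module B = Algebra B
    module f = IsHomomorphism f-isHomomorphism
  open IsEquivalence B.isEquivalence using (refl; sym; trans)
  open SetoidReasoning (algebraSetoid B)

  pseudocomplement-homo : ∀ x → f (x A.*) B.≈ f x B.*
  pseudocomplement-homo x = trans (f.⇒-homo x A.0#) (B.⇒-cong refl f.0-homo)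

  meet-homo : ∀ x → f (x A.∧ x A.′ A.*) B.≈ f x B.∧ f x B.′ B.*
  meet-homo x = begin
    f (x A.∧ x A.′ A.*)        ≈⟨ f.∧-homo x (x A.′ A.*) ⟩
    f x B.∧ f (x A.′ A.*)      ≈⟨ B.∧-cong refl (pseudocomplement-homo (x A.′)) ⟩
    f x B.∧ f (x A.′) B.*      ≈⟨ B.∧-cong refl (B.⇒-cong (f.′-homo x) refl) ⟩
    f x B.∧ f x B.′ B.*        ∎

  joinLaw-pullback : JoinLaw B → JoinLaw A
  joinLaw-pullback join x y z = f-injective (begin
    f (x A.′ A.∨ (y A.⇒ z))                          ≈⟨ f.∨-homo (x A.′) (y A.⇒ z) ⟩
    f (x A.′) B.∨ f (y A.⇒ z)                        ≈⟨ B.∨-cong (f.′-homo x) (f.⇒-homo y z) ⟩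
    f x B.′ B.∨ (f y B.⇒ f z)                        ≈⟨ join (f x) (f y) (f z) ⟩
    (f x B.′ B.∨ f y) B.⇒ (f x B.′ B.∨ f z)          ≈⟨ B.⇒-cong (join-homo y) (join-homo z) ⟨
    f (x A.′ A.∨ y) B.⇒ f (x A.′ A.∨ z)              ≈⟨ f.⇒-homo (x A.′ A.∨ y) (x A.′ A.∨ z) ⟨
    f ((x A.′ A.∨ y) A.⇒ (x A.′ A.∨ z))              ∎)
    where
    join-homo : ∀ y → f (x A.′ A.∨ y) B.≈ f x B.′ B.∨ f y
    join-homo y = trans (f.∨-homo (x A.′) y) (B.∨-cong (f.′-homo x) refl)

  meetCondition-pullback : MeetCondition B → MeetCondition A
  meetCondition-pullback meet x x≉1 = f-injective (begin
    f (x A.∧ x A.′ A.*)    ≈⟨ meet-homo x ⟩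
    f x B.∧ f x B.′ B.*    ≈⟨ meet (f x) (λ fx≈1 → x≉1 (f-injective (trans fx≈1 (sym f.1-homo)))) ⟩
    B.0#                   ≈⟨ f.0-homo ⟨
    f A.0#                 ∎)

≅-sym : {A : Algebra c ℓ} {B : Algebra c₁ ℓ₁} → A ≅ B → B ≅ A
≅-sym {A = A} {B = B} (f , f-isHomomorphism , f-injective , f-surjective) =
  g , record
    { ≈-cong = λ {x} {y} x≈y → f-injective (begin
        f (g x)    ≈⟨ f∘g x ⟩
        x          ≈⟨ x≈y ⟩
        y          ≈⟨ f∘g y ⟨
        f (g y)    ∎)
    ; ∨-homo = λ x y → f-injective (trans (f∘g _)
        (sym (trans (f.∨-homo (g x) (g y)) (B.∨-cong (f∘g x) (f∘g y)))))
    ; ∧-homo = λ x y → f-injective (trans (f∘g _)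
        (sym (trans (f.∧-homo (g x) (g y)) (B.∧-cong (f∘g x) (f∘g y)))))
    ; ⇒-homo = λ x y → f-injective (trans (f∘g _)
        (sym (trans (f.⇒-homo (g x) (g y)) (B.⇒-cong (f∘g x) (f∘g y)))))
    ; ′-homo = λ x → f-injective (trans (f∘g _)
        (sym (trans (f.′-homo (g x)) (B.′-cong (f∘g x)))))
    ; 0-homo = f-injective (trans (f∘g _) (sym f.0-homo))
    ; 1-homo = f-injective (trans (f∘g _) (sym f.1-homo))
    }
  , (λ {x} {y} gx≈gy → begin
      x          ≈⟨ f∘g x ⟨
      f (g x)    ≈⟨ f.≈-cong gx≈gy ⟩
      f (g y)    ≈⟨ f∘g y ⟩
      y          ∎)
  , (λ x → f x , λ z≈fx → f-injective (trans (f∘g _) z≈fx))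
  where
  module A = Algebra A
  module B = Algebra B
  module f = IsHomomorphism f-isHomomorphism
  open IsEquivalence B.isEquivalence using (refl; sym; trans)
  open SetoidReasoning (algebraSetoid B)

  g : B.Carrier → A.Carrier
  g y = proj₁ (f-surjective y)

  f∘g : ∀ y → f (g y) B.≈ y
  f∘g y = proj₂ (f-surjective y) (IsEquivalence.refl A.isEquivalence)

-- Decision by enumeration on Four

index : Four → Fin 4
index 𝟎 = zero
index 𝟏 = suc zero
index 𝐚 = suc (suc zero)
index 𝐛 = suc (suc (suc zero))

index-injective : ∀ {k l} → index k ≡ index l → k ≡ l
index-injective {𝟎} {𝟎} _ = ≡.refl
index-injective {𝟏} {𝟏} _ = ≡.refl
index-injective {𝐚} {𝐚} _ = ≡.refl
index-injective {𝐛} {𝐛} _ = ≡.refl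

_≟_ : DecidableEquality Four
k ≟ l = map′ index-injective (≡.cong index) (index k Fin.≟ index l)

all? : ∀ {p} {P : Pred Four p} → Decidable P → Dec (∀ k → P k)
all? P? = map′
  (λ { (p , q , r , s) → λ { 𝟎 → p ; 𝟏 → q ; 𝐚 → r ; 𝐛 → s } })
  (λ ps → ps 𝟎 , ps 𝟏 , ps 𝐚 , ps 𝐛)
  (P? 𝟎 ×-dec P? 𝟏 ×-dec P? 𝐚 ×-dec P? 𝐛)

joinLaw? : ∀ imp → Dec (JoinLaw (fourElement imp))
joinLaw? imp = all? λ x → all? λ y → all? λ z →
  (x ′ ∨ (y ⇒ z)) ≟ ((x ′ ∨ y) ⇒ (x ′ ∨ z))
  where open Algebra (fourElement imp)

meetCondition? : ∀ imp → Dec (MeetCondition (fourElement imp))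
meetCondition? imp = all? λ x → ¬? (x ≟ 1#) →-dec ((x ∧ x ′ *) ≟ 0#)
  where open Algebra (fourElement imp)

complement₄ : Four → Four
complement₄ 𝟎 = 𝟏
complement₄ 𝟏 = 𝟎
complement₄ 𝐚 = 𝐛
complement₄ 𝐛 = 𝐚

∨-complement₄ : ∀ k → k ⊔₄ complement₄ k ≡ 𝟏
∨-complement₄ = from-yes (all? λ k → (k ⊔₄ complement₄ k) ≟ 𝟏)

∧-complement₄ : ∀ k → k ⊓₄ complement₄ k ≡ 𝟎
∧-complement₄ = from-yes (all? λ k → (k ⊓₄ complement₄ k) ≟ 𝟎)

-- Two elements are equal if each of them is disjoint from the complement of
-- the other.
disjoint-complements⇒≡ : ∀ k l → k ⊓₄ complement₄ l ≡ 𝟎 →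
                         l ⊓₄ complement₄ k ≡ 𝟎 → k ≡ l
disjoint-complements⇒≡ = from-yes (all? λ k → all? λ l →
  ((k ⊓₄ complement₄ l) ≟ 𝟎) →-dec (((l ⊓₄ complement₄ k) ≟ 𝟎) →-dec (k ≟ l)))

-- The operation imp is given by the expression for ⇒ in terms of
-- complements and of the element 0 ⇒ 1.
IsDeterminedBy01 : (Four → Four → Four) → Set
IsDeterminedBy01 imp = ∀ k l →
  imp k l ≡ (k ⊓₄ l) ⊔₄ (complement₄ k ⊓₄ ((l ⊓₄ imp 𝟎 𝟏) ⊔₄ complement₄ l))

isDeterminedBy01? : ∀ imp → Dec (IsDeterminedBy01 imp)
isDeterminedBy01? imp = all? λ k → all? λ l → imp k l ≟ _

-- Recognising the four-element algebras

-- The elements w and u are nonzero complements of each other, are fixed by ′,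
-- and each of them is maximal among the elements different from 1.  Maximality
-- is stated as a dichotomy for an arbitrary z, not only for z above w or u.
record IsFixedPair (L : Algebra c ℓ) (w u : Algebra.Carrier L) : Set (c ⊔ ℓ) where
  open Algebra L
  field
    ∨≈1   : w ∨ u ≈ 1#
    ∧≈0   : w ∧ u ≈ 0#
    w′≈w  : w ′ ≈ w
    u′≈u  : u ′ ≈ u
    w≉0   : ¬ w ≈ 0#
    u≉0   : ¬ u ≈ 0#
    w-max : ∀ z → z ∨ w ≈ 1# ⊎ z ≤ w
    u-max : ∀ z → z ∨ u ≈ 1# ⊎ z ≤ u

module FixedPair (L : Algebra c ℓ) (isDQD : L ∈ DQD) {w u : Algebra.Carrier L}
                 (isFixedPair : IsFixedPair L w u) where
  open Algebra L
  open DQDProperties L isDQD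
  open IsFixedPair isFixedPair
  open SetoidReasoning setoid

  u∨w≈1 : u ∨ w ≈ 1#
  u∨w≈1 = trans (∨-comm u w) ∨≈1

  u∧w≈0 : u ∧ w ≈ 0#
  u∧w≈0 = trans (∧-comm u w) ∧≈0

  isFixedPair-sym : IsFixedPair L u w
  isFixedPair-sym = record
    { ∨≈1 = u∨w≈1 ; ∧≈0 = u∧w≈0 ; w′≈w = u′≈u ; u′≈u = w′≈w
    ; w≉0 = u≉0 ; u≉0 = w≉0 ; w-max = u-max ; u-max = w-max }

  1≉0 : ¬ 1# ≈ 0#
  1≉0 1≈0 = w≉0 (begin
    w       ≈⟨ ∧-identityʳ w ⟨
    w ∧ 1#  ≈⟨ ∧-congˡ 1≈0 ⟩
    w ∧ 0#  ≈⟨ ∧-zeroʳ w ⟩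
    0#      ∎)

  embed : Four → Carrier
  embed 𝟎 = 0#
  embed 𝟏 = 1#
  embed 𝐚 = w
  embed 𝐛 = u

  embed-cong : ∀ {k l} → k ≡ l → embed k ≈ embed l
  embed-cong k≡l = reflexive (≡.cong embed k≡l)

  embed-∨ : ∀ k l → embed (k ⊔₄ l) ≈ embed k ∨ embed l
  embed-∨ 𝟎 l = sym (∨-identityˡ (embed l))
  embed-∨ 𝟏 l = sym (∨-zeroˡ (embed l))
  embed-∨ 𝐚 𝟎 = sym (∨-identityʳ w)
  embed-∨ 𝐚 𝟏 = sym (∨-zeroʳ w)
  embed-∨ 𝐚 𝐚 = sym (∨-idem w)
  embed-∨ 𝐚 𝐛 = sym ∨≈1
  embed-∨ 𝐛 𝟎 = sym (∨-identityʳ u)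
  embed-∨ 𝐛 𝟏 = sym (∨-zeroʳ u)
  embed-∨ 𝐛 𝐚 = sym u∨w≈1
  embed-∨ 𝐛 𝐛 = sym (∨-idem u)

  embed-∧ : ∀ k l → embed (k ⊓₄ l) ≈ embed k ∧ embed l
  embed-∧ 𝟎 l = sym (∧-zeroˡ (embed l))
  embed-∧ 𝟏 l = sym (∧-identityˡ (embed l))
  embed-∧ 𝐚 𝟎 = sym (∧-zeroʳ w)
  embed-∧ 𝐚 𝟏 = sym (∧-identityʳ w)
  embed-∧ 𝐚 𝐚 = sym (∧-idem w)
  embed-∧ 𝐚 𝐛 = sym ∧≈0
  embed-∧ 𝐛 𝟎 = sym (∧-zeroʳ u)
  embed-∧ 𝐛 𝟏 = sym (∧-identityʳ u)
  embed-∧ 𝐛 𝐚 = sym u∧w≈0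
  embed-∧ 𝐛 𝐛 = sym (∧-idem u)

  embed-′ : ∀ k → embed (neg₄ k) ≈ embed k ′
  embed-′ 𝟎 = sym 0′≈1
  embed-′ 𝟏 = sym 1′≈0
  embed-′ 𝐚 = sym w′≈w
  embed-′ 𝐛 = sym u′≈u

  embed-∨-complement : ∀ k → embed k ∨ embed (complement₄ k) ≈ 1#
  embed-∨-complement k = trans (sym (embed-∨ k _)) (embed-cong (∨-complement₄ k))

  embed-∧-complement : ∀ k → embed k ∧ embed (complement₄ k) ≈ 0#
  embed-∧-complement k = trans (sym (embed-∧ k _)) (embed-cong (∧-complement₄ k))

  embed≈0⇒≡𝟎 : ∀ k → embed k ≈ 0# → k ≡ 𝟎
  embed≈0⇒≡𝟎 𝟎 _   = ≡.refl
  embed≈0⇒≡𝟎 𝟏 1≈0 = ⊥-elim (1≉0 1≈0)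
  embed≈0⇒≡𝟎 𝐚 w≈0 = ⊥-elim (w≉0 w≈0)
  embed≈0⇒≡𝟎 𝐛 u≈0 = ⊥-elim (u≉0 u≈0)

  embed-injective : ∀ {k l} → embed k ≈ embed l → k ≡ l
  embed-injective {k} {l} k≈l =
    disjoint-complements⇒≡ k l (disjoint k l k≈l) (disjoint l k (sym k≈l))
    where
    disjoint : ∀ k l → embed k ≈ embed l → k ⊓₄ complement₄ l ≡ 𝟎
    disjoint k l k≈l = embed≈0⇒≡𝟎 (k ⊓₄ complement₄ l) (begin
      embed (k ⊓₄ complement₄ l)        ≈⟨ embed-∧ k (complement₄ l) ⟩
      embed k ∧ embed (complement₄ l)   ≈⟨ ∧-congʳ k≈l ⟩
      embed l ∧ embed (complement₄ l)   ≈⟨ embed-∧-complement l ⟩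
      0#                                ∎)

  embed-onto : ∀ z → ∃[ k ] embed k ≈ z
  embed-onto z with w-max z | u-max z
  ... | inj₁ z∨w≈1 | inj₁ z∨u≈1 =
    𝟏 , separate ∨≈1 (trans (∧-identityʳ w) (sym (cover⇒≤ z∨u≈1 ∧≈0)))
                     (trans (∧-identityʳ u) (sym (cover⇒≤ z∨w≈1 u∧w≈0)))
  ... | inj₁ z∨w≈1 | inj₂ z≤u = 𝐛 , ≤-antisym (cover⇒≤ z∨w≈1 u∧w≈0) z≤u
  ... | inj₂ z≤w | inj₁ z∨u≈1 = 𝐚 , ≤-antisym (cover⇒≤ z∨u≈1 ∧≈0) z≤w
  ... | inj₂ z≤w | inj₂ z≤u   = 𝟎 , sym (begin
    z            ≈⟨ z≤u ⟨
    z ∧ u        ≈⟨ ∧-congʳ z≤w ⟨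
    (z ∧ w) ∧ u  ≈⟨ ∧-assoc z w u ⟩
    z ∧ (w ∧ u)  ≈⟨ ∧-congˡ ∧≈0 ⟩
    z ∧ 0#       ≈⟨ ∧-zeroʳ z ⟩
    0#           ∎)

  module _ {imp : Four → Four → Four} (determined : IsDeterminedBy01 imp)
           (01-agree : embed (imp 𝟎 𝟏) ≈ 0# ⇒ 1#) where

    embed-⇒ : ∀ k l → embed (imp k l) ≈ embed k ⇒ embed l
    embed-⇒ k l = begin
      embed (imp k l)
        ≈⟨ embed-cong (determined k l) ⟩
      embed ((k ⊓₄ l) ⊔₄ (complement₄ k ⊓₄ ((l ⊓₄ imp 𝟎 𝟏) ⊔₄ complement₄ l)))
        ≈⟨ embed-∨ (k ⊓₄ l) _ ⟩
      embed (k ⊓₄ l) ∨ embed (complement₄ k ⊓₄ ((l ⊓₄ imp 𝟎 𝟏) ⊔₄ complement₄ l))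
        ≈⟨ ∨-cong (embed-∧ k l) (embed-∧ (complement₄ k) _) ⟩
      (embed k ∧ embed l) ∨ (k̄ ∧ embed ((l ⊓₄ imp 𝟎 𝟏) ⊔₄ complement₄ l))
        ≈⟨ ∨-congˡ (∧-congˡ (embed-∨ (l ⊓₄ imp 𝟎 𝟏) (complement₄ l))) ⟩
      (embed k ∧ embed l) ∨ (k̄ ∧ (embed (l ⊓₄ imp 𝟎 𝟏) ∨ l̄))
        ≈⟨ ∨-congˡ (∧-congˡ (∨-congʳ (trans (embed-∧ l (imp 𝟎 𝟏)) (∧-congˡ 01-agree)))) ⟩
      (embed k ∧ embed l) ∨ (k̄ ∧ ((embed l ∧ (0# ⇒ 1#)) ∨ l̄))
        ≈⟨ ⇒-by-complements (embed-∨-complement k) (embed-∧-complement k)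
                            (embed-∨-complement l) (embed-∧-complement l) ⟨
      embed k ⇒ embed l
        ∎
      where
      k̄ = embed (complement₄ k)
      l̄ = embed (complement₄ l)

    isomorphic : L ≅ fourElement imp
    isomorphic = ≅-sym
      ( embed
      , record
        { ≈-cong = embed-cong
        ; ∨-homo = embed-∨
        ; ∧-homo = embed-∧
        ; ⇒-homo = embed-⇒
        ; ′-homo = embed-′
        ; 0-homo = refl
        ; 1-homo = refl
        }
      , embed-injective
      , λ z → proj₁ (embed-onto z) ,
              λ { ≡.refl → proj₂ (embed-onto z) }
      )

fixedPair⇒≅D : (L : Algebra c ℓ) → L ∈ DQD → ∀ {w u} → IsFixedPair L w u →
               L ≅ D₁ ⊎ L ≅ D₂ ⊎ L ≅ D₃
fixedPair⇒≅D L isDQD isFixedPair = classify (embed-onto (0# ⇒ 1#))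
  where
  open Algebra L
  open FixedPair L isDQD isFixedPair
  module Swapped = FixedPair L isDQD isFixedPair-sym

  classify : ∃[ e ] embed e ≈ 0# ⇒ 1# → L ≅ D₁ ⊎ L ≅ D₂ ⊎ L ≅ D₃
  classify (𝟎 , agree) = inj₁ (isomorphic (from-yes (isDeterminedBy01? imp₁)) agree)
  classify (𝟏 , agree) = inj₂ (inj₁ (isomorphic (from-yes (isDeterminedBy01? imp₂)) agree))
  classify (𝐚 , agree) = inj₂ (inj₂ (isomorphic (from-yes (isDeterminedBy01? imp₃)) agree))
  -- In D₃ the value of 0 ⇒ 1 is 𝐚, so here the second atom must play that role.
  classify (𝐛 , agree) = inj₂ (inj₂ (Swapped.isomorphic (from-yes (isDeterminedBy01? imp₃)) agree))

-- The equivalence of (c) and (d)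

module MeetConditionProperties
  (em : ExcludedMiddle (c ⊔ ℓ)) (L : Algebra c ℓ) (isDQD : L ∈ DQD)
  (meet : MeetCondition L) where
  open Algebra L
  open DQDProperties L isDQD
  open SetoidReasoning setoid

  decide : (x y : Carrier) → Dec (x ≈ y)
  decide x y = map′ lower lift (em {P = Lift c (x ≈ y)})

  -- Both sides of the law are 1 at x ≈ 1, and both are 0 elsewhere.
  levelLaw : LevelLaw L
  levelLaw x with decide x 1#
  ... | yes x≈1 = trans y≈1 (sym (trans (⇒-cong (′-cong y≈1) refl) 1′*≈1))
    where
    y≈1 : x ∧ x ′ * ≈ 1#
    y≈1 = trans (∧-cong x≈1 (trans (⇒-cong (′-cong x≈1) refl) 1′*≈1)) (∧-idem 1#)
  ... | no x≉1 = trans (meet x x≉1)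
                       (sym (trans (⇒-cong (′-cong (meet x x≉1)) refl) 0′*≈0))

  module _ (stone : ∀ x → x ′ ∧ x ′ ′ ≈ 0#) where

    -- Here x″ lies below x″′*, so the condition on x″ ∧ x″′* makes x″ either
    -- 0 or 1, and x′ ≈ x″′ inherits this.
    ′-two-valued : ∀ x → x ′ ≈ 0# ⊎ x ′ ≈ 1#
    ′-two-valued x with decide (x ′ ′) 1#
    ... | yes x″≈1 = inj₁ (trans (sym (′′′≈′ x)) (trans (′-cong x″≈1) 1′≈0))
    ... | no x″≉1  = inj₂ (trans (sym (′′′≈′ x)) (trans (′-cong x″≈0) 0′≈1))
      where
      x″≈0 : x ′ ′ ≈ 0#
      x″≈0 = begin
        x ′ ′                ≈⟨ disjoint⇒≤* (trans (∧-congˡ (′′′≈′ x)) (trans (∧-comm _ _) (stone x))) ⟨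
        x ′ ′ ∧ x ′ ′ ′ *    ≈⟨ meet (x ′ ′) x″≉1 ⟩
        0#                   ∎

    stone⇒joinLaw : JoinLaw L
    stone⇒joinLaw x y z with ′-two-valued x
    ... | inj₁ x′≈0 = trans (0∨ (y ⇒ z)) (⇒-cong (sym (0∨ y)) (sym (0∨ z)))
      where
      0∨ : ∀ t → x ′ ∨ t ≈ t
      0∨ t = trans (∨-congʳ x′≈0) (∨-identityˡ t)
    ... | inj₂ x′≈1 = trans (1∨ (y ⇒ z))
                            (sym (trans (⇒-cong (1∨ y) (1∨ z)) (⇒-refl 1#)))
      where
      1∨ : ∀ t → x ′ ∨ t ≈ 1#
      1∨ t = trans (∨-congʳ x′≈1) (∨-zeroˡ t)

  module _ (join : JoinLaw L) where

    ≉1⇒≤′ : ∀ {z} → ¬ z ≈ 1# → z ≤ z ′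
    ≉1⇒≤′ {z} z≉1 = cover⇒≤ (joinLaw⇒′-cover join z) (meet z z≉1)

    ′′-fixed⇒′-fixed : ∀ {z} → z ′ ′ ≈ z → ¬ z ≈ 0# → ¬ z ≈ 1# → z ′ ≈ z
    ′′-fixed⇒′-fixed {z} z″≈z z≉0 z≉1 = ≤-antisym z′≤z (≉1⇒≤′ z≉1)
      where
      z′≉1 : ¬ z ′ ≈ 1#
      z′≉1 z′≈1 = z≉0 (trans (sym z″≈z) (trans (′-cong z′≈1) 1′≈0))

      z′≤z : z ′ ≤ z
      z′≤z = ≤-respʳ z″≈z (≉1⇒≤′ z′≉1)

    ′-fixed⇒maximal : ∀ {v} → v ′ ≈ v → ∀ z → z ∨ v ≈ 1# ⊎ z ≤ v
    ′-fixed⇒maximal {v} v′≈v z with decide (z ∨ v) 1#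
    ... | yes z∨v≈1 = inj₁ z∨v≈1
    ... | no z∨v≉1  = inj₂ (≤-trans (x≤x∨y z v)
                           (≤-trans (≉1⇒≤′ z∨v≉1)
                           (≤-respʳ v′≈v (′-antitone v≤z∨v))))
      where
      v≤z∨v : v ≤ z ∨ v
      v≤z∨v = ≤-respʳ (∨-comm v z) (x≤x∨y v z)

    nonStone⇒fixedPair : ∀ {x} → ¬ x ′ ∧ x ′ ′ ≈ 0# → IsFixedPair L (x ′) (x ′ *)
    nonStone⇒fixedPair {x} x′∧x″≉0 = record
      { ∨≈1   = w∨u≈1
      ; ∧≈0   = w∧u≈0
      ; w′≈w  = w′≈w
      ; u′≈u  = u′≈u
      ; w≉0   = w≉0
      ; u≉0   = u≉0
      ; w-max = ′-fixed⇒maximal w′≈w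
      ; u-max = ′-fixed⇒maximal u′≈u
      }
      where
      w u : Carrier
      w = x ′
      u = w *

      w∨u≈1 : w ∨ u ≈ 1#
      w∨u≈1 = joinLaw⇒′-cover join x

      w∧u≈0 : w ∧ u ≈ 0#
      w∧u≈0 = x∧x*≈0 w

      w≉0 : ¬ w ≈ 0#
      w≉0 w≈0 = x′∧x″≉0 (trans (∧-congʳ w≈0) (∧-zeroˡ (w ′)))

      w≉1 : ¬ w ≈ 1#
      w≉1 w≈1 = x′∧x″≉0 (trans (∧-congˡ (trans (′-cong w≈1) 1′≈0)) (∧-zeroʳ w))

      u≉0 : ¬ u ≈ 0#
      u≉0 u≈0 = w≉1 (begin
        w       ≈⟨ ∨-identityʳ w ⟨
        w ∨ 0#  ≈⟨ ∨-congˡ u≈0 ⟨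
        w ∨ u   ≈⟨ w∨u≈1 ⟩
        1#      ∎)

      u≉1 : ¬ u ≈ 1#
      u≉1 u≈1 = w≉0 (begin
        w       ≈⟨ ∧-identityʳ w ⟨
        w ∧ 1#  ≈⟨ ∧-congˡ u≈1 ⟨
        w ∧ u   ≈⟨ w∧u≈0 ⟩
        0#      ∎)

      w′≈w : w ′ ≈ w
      w′≈w = ′′-fixed⇒′-fixed (′′′≈′ x) w≉0 w≉1

      u″∨w≈1 : u ′ ′ ∨ w ≈ 1#
      u″∨w≈1 = begin
        u ′ ′ ∨ w        ≈⟨ ∨-congˡ (′′′≈′ x) ⟨
        u ′ ′ ∨ w ′ ′    ≈⟨ ∨-′′ u w ⟨
        (u ∨ w) ′ ′      ≈⟨ ′-cong (′-cong (trans (∨-comm u w) w∨u≈1)) ⟩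
        1# ′ ′           ≈⟨ ′-cong 1′≈0 ⟩
        0# ′             ≈⟨ 0′≈1 ⟩
        1#               ∎

      u′≈u : u ′ ≈ u
      u′≈u = ′′-fixed⇒′-fixed
        (≤-antisym (′′-≤ u) (cover⇒≤ u″∨w≈1 (trans (∧-comm u w) w∧u≈0)))
        u≉0 u≉1

    dichotomy : (L ≅ D₁ ⊎ L ≅ D₂ ⊎ L ≅ D₃) ⊎ L ∈ DSt
    dichotomy with em {P = ∃[ x ] ¬ x ′ ∧ x ′ ′ ≈ 0#}
    ... | yes (_ , x′∧x″≉0) = inj₁ (fixedPair⇒≅D L isDQD (nonStone⇒fixedPair x′∧x″≉0))
    ... | no none = inj₂ (isDQD , λ x →
      decidable-stable (decide (x ′ ∧ x ′ ′) 0#) λ x′∧x″≉0 → none (x , x′∧x″≉0))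

module _ (em : ExcludedMiddle (c ⊔ ℓ)) (L : Algebra c ℓ) (isDQD : L ∈ DQD) where

  joinLaw∧meetCondition⇒JID₁ : JoinLaw L → MeetCondition L → L ∈ JID₁ × MeetCondition L
  joinLaw∧meetCondition⇒JID₁ join meet =
    ((isDQD , join) , MeetConditionProperties.levelLaw em L isDQD meet) , meet

  DSt⇒JID₁ : L ∈ DSt → MeetCondition L → L ∈ JID₁ × MeetCondition L
  DSt⇒JID₁ (_ , stone) meet = joinLaw∧meetCondition⇒JID₁
    (MeetConditionProperties.stone⇒joinLaw em L isDQD meet stone) meet

  ≅⇒JID₁ : ∀ {imp} → JoinLaw (fourElement imp) → MeetCondition (fourElement imp) →
           L ≅ fourElement imp → L ∈ JID₁ × MeetCondition L
  ≅⇒JID₁ join meet (f , f-isHomomorphism , f-injective , _) =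
    joinLaw∧meetCondition⇒JID₁
      (joinLaw-pullback f-isHomomorphism f-injective join)
      (meetCondition-pullback f-isHomomorphism f-injective meet)

  ≅D⇒JID₁ : L ≅ D₁ ⊎ L ≅ D₂ ⊎ L ≅ D₃ → L ∈ JID₁ × MeetCondition L
  ≅D⇒JID₁ (inj₁ L≅D₁) =
    ≅⇒JID₁ (from-yes (joinLaw? imp₁)) (from-yes (meetCondition? imp₁)) L≅D₁
  ≅D⇒JID₁ (inj₂ (inj₁ L≅D₂)) =
    ≅⇒JID₁ (from-yes (joinLaw? imp₂)) (from-yes (meetCondition? imp₂)) L≅D₂
  ≅D⇒JID₁ (inj₂ (inj₂ L≅D₃)) =
    ≅⇒JID₁ (from-yes (joinLaw? imp₃)) (from-yes (meetCondition? imp₃)) L≅D₃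

theorem5p9 :
    {c ℓ : Level} → ExcludedMiddle (c ⊔ ℓ) →
    (L : Algebra c ℓ) → L ∈ DQD → MoreThanTwo L →
    let cond-a = L ∈ JID₁ × SubdirectlyIrreducible L
        cond-b = L ∈ JID₁ × Simple L
        cond-c = L ∈ JID₁ × MeetCondition L
        cond-d = (L ≅ D₁ ⊎ L ≅ D₂ ⊎ L ≅ D₃) ⊎ (L ∈ DSt × MeetCondition L)
    in (cond-a ⇔ cond-b) × (cond-b ⇔ cond-c) × (cond-c ⇔ cond-d)
theorem5p9 {c} {ℓ} em L isDQD moreThanTwo =
  mk⇔ (c⇒b ∘ a⇒c) b⇒a , mk⇔ (a⇒c ∘ b⇒a) c⇒b , mk⇔ c⇒d d⇒c
  where
  cond-a cond-b cond-c cond-d : Set _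
  cond-a = L ∈ JID₁ × SubdirectlyIrreducible L
  cond-b = L ∈ JID₁ × Simple L
  cond-c = L ∈ JID₁ × MeetCondition L
  cond-d = (L ≅ D₁ ⊎ L ≅ D₂ ⊎ L ≅ D₃) ⊎ (L ∈ DSt × MeetCondition L)

  b⇒a : cond-b → cond-a
  b⇒a (jid₁ , simple) = jid₁ , simple⇒SI em L moreThanTwo simple

  a⇒c : cond-a → cond-c
  a⇒c (jid₁ , si) = jid₁ , SI⇒meetCondition L jid₁ si

  c⇒b : cond-c → cond-b
  c⇒b (jid₁ , meet) = jid₁ , meetCondition⇒simple em L isDQD meet

  c⇒d : cond-c → cond-d
  c⇒d (((_ , join) , _) , meet)
    with MeetConditionProperties.dichotomy em L isDQD meet join
  ... | inj₁ L≅D  = inj₁ L≅D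
  ... | inj₂ L∈DSt = inj₂ (L∈DSt , meet)

  d⇒c : cond-d → cond-c
  d⇒c (inj₁ L≅D)           = ≅D⇒JID₁ em L isDQD L≅D
  d⇒c (inj₂ (L∈DSt , meet)) = DSt⇒JID₁ em L isDQD L∈DSt meet
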